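{- Let $\phi$ be a formula in the language of $\mathbf{PT}_0$ whose propositional variables are among $p_{i_1},\dots,p_{i_n}$ (with $n\geq 1$ and $i_1,\dots,i_n$ distinct). Then $\phi$ is semantically equivalent to a formula in the language of $\mathbf{PD}^{\vee}$ of the form (disjunctive normal form) $$\bigvee_{f\in F}\ \bigotimes_{s\in X_f}\bigl(p_{i_1}^{s(i_1)}\wedge\dots\wedge p_{i_n}^{s(i_n)}\bigr),$$ and also to a formula in the language of $\mathbf{InqL}$ (hence of $\mathbf{PID}$) of the form (disjunctive-negative normal form) $$\bigvee_{f\in F}\ \neg\neg\bigvee_{s\in X_f}\bigl(p_{i_1}^{s(i_1)}\wedge\dots\wedge p_{i_n}^{s(i_n)}\bigr),$$ where $F$ is a nonempty finite set of indices and each $X_f$ is a team on $\{i_1,\dots,i_n\}$.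
   Context: Propositional variables are $p_i$, $i\in\mathbb{N}$. A valuation is a function $s:\mathbb{N}\to\{0,1\}$; a team is a set of valuations. A team on a finite set $N\subseteq\mathbb{N}$ is a set of functions $N\to\{0,1\}$. Formulas of $\mathbf{PT}_0$ are given by $$\phi::=p_i\mid\neg p_i\mid\bot\mid\mathop{=}(p_{i_1},\dots,p_{i_k},p_j)\mid(\phi\wedge\phi)\mid(\phi\otimes\phi)\mid(\phi\vee\phi)\mid(\phi\to\phi),$$ where $k\ge 0$. Truth on a team $X$ is defined by: - $X\models p_i$ iff $s(i)=1$ for all $s\in X$; $X\models\neg p_i$ iff $s(i)=0$ for all $s\in X$; $X\models\bot$ iff $X=\emptyset$; - $X\models\mathop{=}(p_{i_1},\dots,p_{i_k},p_j)$ iff for all $s,s'\in X$, if $s(i_1)=s'(i_1),\dots,s(i_k)=s'(i_k)$ then $s(j)=s'(j)$; - $X\models\phi\wedge\psi$ iff $X\models\phi$ and $X\models\psi$; - $X\models\phi\otimes\psi$ iff there are $Y,Z\subseteq X$ with $X=Y\cup Z$, $Y\models\phi$ and $Z\models\psi$; - $X\models\phi\vee\psi$ iff $X\models\phi$ or $X\models\psi$; - $X\models\phi\to\psi$ iff for all $Y\subseteq X$, $Y\models\phi$ implies $Y\models\psi$. For arbitrary $\phi$, $\neg\phi$ abbreviates $\phi\to\bot$ (on a variable this has the same semantics as the atom $\neg p_i$, and in $\mathbf{InqL}$ and $\mathbf{PID}$ the formula $\neg p_i$ is read as $p_i\to\bot$). Formulas are semantically equivalent if they are true on the same teams. $\mathbf{PD}^{\vee}$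 has atoms $p_i,\neg p_i,\bot$ and connectives $\wedge,\otimes,\vee$. $\mathbf{InqL}$ has atoms $p_i,\bot$ and connectives $\wedge,\vee,\to$. $\mathbf{PID}$ has in addition to $\mathbf{InqL}$ the dependence atoms. Notation: $p_i^1:=p_i$, $p_i^0:=\neg p_i$. When $X_f=\emptyset$, both $\bigotimes_{s\in X_f}(\dots)$ and $\neg\neg\bigvee_{s\in X_f}(\dots)$ stand for $\bot$. -}

module Defs where

open import Data.Bool.Base using (Bool; true; false)
open import Data.Fin.Base using (Fin)
open import Data.List.Base as List using (List; []; _∷_; _++_)
open import Data.List.Relation.Unary.All using (All)
open import Data.List.Relation.Unary.Unique.Propositional using (Unique)
open import Data.Nat.Base using (ℕ; suc)
open import Data.Product.Base using (Σ-syntax; _×_)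
open import Data.Sum.Base using (_⊎_)
open import Data.Vec.Base as Vec using (Vec; foldr₁; zipWith; tabulate; fromList)
open import Function.Bundles using (_⇔_)
open import Level using (0ℓ; Lift) renaming (suc to lsuc)
open import Relation.Binary.PropositionalEquality using (_≡_)
open import Relation.Unary using (Pred; _∈_; _⊆_; _≐_; _∪_; Empty)

infixr 7 _∧_
infixr 6 _⊗_ _∨_
infixr 5 _⇒_
infix  8 ~_
infix  4 _⊨_ _≋_

Valuation : Set
Valuation = ℕ → Bool

Team : Set₁
Team = Pred Valuation 0ℓ

-- The language PT₀; dep (i₁ ∷ … ∷ iₖ ∷ []) j is =(p_{i₁}, …, p_{iₖ}, p_j).
data Formula : Set where
  var negvar      : ℕ → Formula
  bot             : Formula
  dep             : List ℕ → ℕ → Formula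
  _∧_ _⊗_ _∨_ _⇒_ : Formula → Formula → Formula

~_ : Formula → Formula
~ φ = φ ⇒ bot

vars : Formula → List ℕ
vars (var i)    = i ∷ []
vars (negvar i) = i ∷ []
vars bot        = []
vars (dep is j) = is ++ j ∷ []
vars (φ ∧ ψ)    = vars φ ++ vars ψ
vars (φ ⊗ ψ)    = vars φ ++ vars ψ
vars (φ ∨ ψ)    = vars φ ++ vars ψ
vars (φ ⇒ ψ)    = vars φ ++ vars ψ

-- Truth quantifies over teams, hence lands in Set₁; the Lifts on atoms only
-- adjust the universe level.
_⊨_ : Team → Formula → Set₁
X ⊨ var i    = Lift (lsuc 0ℓ) (∀ s → s ∈ X → s i ≡ true)
X ⊨ negvar i = Lift (lsuc 0ℓ) (∀ s → s ∈ X → s i ≡ false)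
X ⊨ bot      = Lift (lsuc 0ℓ) (Empty X)
X ⊨ dep is j = Lift (lsuc 0ℓ)
  (∀ s s′ → s ∈ X → s′ ∈ X → All (λ i → s i ≡ s′ i) is → s j ≡ s′ j)
X ⊨ φ ∧ ψ    = X ⊨ φ × X ⊨ ψ
X ⊨ φ ⊗ ψ    = Σ[ Y ∈ Team ] Σ[ Z ∈ Team ]
  Y ⊆ X × Z ⊆ X × X ≐ Y ∪ Z × Y ⊨ φ × Z ⊨ ψ
X ⊨ φ ∨ ψ    = X ⊨ φ ⊎ X ⊨ ψ
X ⊨ φ ⇒ ψ    = (Y : Team) → Y ⊆ X → Y ⊨ φ → Y ⊨ ψ

-- Semantic equivalence.
_≋_ : Formula → Formula → Set₁
φ ≋ ψ = (X : Team) → X ⊨ φ ⇔ X ⊨ ψ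

data PD∨ : Formula → Set where
  var    : ∀ i → PD∨ (var i)
  negvar : ∀ i → PD∨ (negvar i)
  bot    : PD∨ bot
  _∧_    : ∀ {φ ψ} → PD∨ φ → PD∨ ψ → PD∨ (φ ∧ ψ)
  _⊗_    : ∀ {φ ψ} → PD∨ φ → PD∨ ψ → PD∨ (φ ⊗ ψ)
  _∨_    : ∀ {φ ψ} → PD∨ φ → PD∨ ψ → PD∨ (φ ∨ ψ)

data InqL : Formula → Set where
  var : ∀ i → InqL (var i)
  bot : InqL bot
  _∧_ : ∀ {φ ψ} → InqL φ → InqL ψ → InqL (φ ∧ ψ)
  _∨_ : ∀ {φ ψ} → InqL φ → InqL ψ → InqL (φ ∨ ψ)
  _⇒_ : ∀ {φ ψ} → InqL φ → InqL ψ → InqL (φ ⇒ ψ)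

data PID : Formula → Set where
  var : ∀ i → PID (var i)
  bot : PID bot
  dep : ∀ is j → PID (dep is j)
  _∧_ : ∀ {φ ψ} → PID φ → PID ψ → PID (φ ∧ ψ)
  _∨_ : ∀ {φ ψ} → PID φ → PID ψ → PID (φ ∨ ψ)
  _⇒_ : ∀ {φ ψ} → PID φ → PID ψ → PID (φ ⇒ ψ)

-- A team on {i₁, …, iₙ}, for fixed distinct i₁, …, iₙ: a function
-- s : {i₁, …, iₙ} → {0,1} is the vector (s(i₁), …, s(iₙ)), and a set of such
-- functions is a repetition-free list.
record FinTeam (n : ℕ) : Set where
  constructor finTeam
  field
    elements : List (Vec Bool n)
    unique   : Unique elements

open FinTeam public

-- p_i^b in PD∨, where ¬p_i is an atom.
lit : ℕ → Bool → Formula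
lit i true  = var i
lit i false = negvar i

-- p_i^b in InqL and PID, where ¬p_i is read as p_i → ⊥.
lit⇒ : ℕ → Bool → Formula
lit⇒ i true  = var i
lit⇒ i false = ~ var i

module _ {n : ℕ} (is : Vec ℕ (suc n)) where

  -- p_{i₁}^{s(i₁)} ∧ … ∧ p_{iₙ}^{s(iₙ)}
  literals literals⇒ : Vec Bool (suc n) → Formula
  literals  s = foldr₁ _∧_ (zipWith lit  is s)
  literals⇒ s = foldr₁ _∧_ (zipWith lit⇒ is s)

-- The empty cases follow the convention that ⨂ and ¬¬⋁ over the empty
-- team both stand for ⊥.
⨂ : List Formula → Formula
⨂ []       = bot
⨂ (φ ∷ φs) = foldr₁ _⊗_ (fromList (φ ∷ φs))

¬¬⋁ : List Formula → Formula
¬¬⋁ []       = bot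
¬¬⋁ (φ ∷ φs) = ~ ~ foldr₁ _∨_ (fromList (φ ∷ φs))

-- The index set F is Fin (suc m), an arbitrary nonempty finite set.
⋁ : {m : ℕ} → (Fin (suc m) → Formula) → Formula
⋁ φ = foldr₁ _∨_ (tabulate φ)

dnf dnnf : {n m : ℕ} → Vec ℕ (suc n) → (Fin (suc m) → FinTeam (suc n)) → Formula
dnf  is X = ⋁ λ f → ⨂   (List.map (literals  is) (elements (X f)))
dnnf is X = ⋁ λ f → ¬¬⋁ (List.map (literals⇒ is) (elements (X f)))

{-# OPTIONS --safe #-}
-- On variables among is, truth of φ on X depends only on the finite image T of
-- X under s ↦ (s(i₁), …, s(iₙ)), and X ⊨ φ can be restated as a relation T ⊩ φ
-- quantifying over finite teams only. Being small, T ⊩ φ is decided by excluded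
-- middle, so the finite teams satisfying φ can be listed; by downward closure
-- X ⊨ φ iff the image of X is contained in a listed team. Containment of the
-- image in T is what both ⨂ and ¬¬⋁ over T express.
module Submission where

open import Defs
open import Axiom.ExcludedMiddle using (ExcludedMiddle)
open import Data.Bool.Base using (Bool; true; false)
import Data.Bool.Properties as Bool
open import Data.Fin.Base using (Fin)
open import Data.List.Base as List using (List; []; _∷_; _++_; deduplicate; filter)
open import Data.List.Membership.Propositional using () renaming (_∈_ to _∈ₗ_)
open import Data.List.Membership.Propositional.Properties
  using (∈-++⁺ˡ; ∈-++⁺ʳ; ∈-++⁻; ∈-map⁺; ∈-filter⁺; ∈-filter⁻;
         ∈-lookup; ∈-deduplicate⁺; ∈-deduplicate⁻)
open import Data.List.Relation.Binary.Subset.Propositional using (_⊆_)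
open import Data.List.Relation.Unary.All as All using (All)
import Data.List.Relation.Unary.All.Properties as All
open import Data.List.Relation.Unary.Any as Any using (Any; here; there; any?)
open import Data.List.Relation.Unary.Any.Properties as Any using (lookup-index)
open import Data.List.Relation.Unary.Unique.DecPropositional.Properties using (deduplicate-!)
open import Data.Nat.Base using (ℕ; zero; suc)
open import Data.Nat.Properties using (_≟_)
open import Data.Product.Base using (Σ-syntax; ∃-syntax; _×_; _,_; proj₁; proj₂)
open import Data.Product.Function.NonDependent.Propositional using (_×-⇔_)
open import Data.Sum.Base as Sum using (_⊎_; inj₁; inj₂; [_,_]′)
open import Data.Sum.Function.Propositional using (_⊎-⇔_)
open import Data.Vec.Base as Vec using (Vec; []; _∷_; toList; foldr₁; zipWith)
open import Data.Vec.Properties using (∷-injective; ≡-dec)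
open import Data.Vec.Relation.Unary.All as VecAll using ([]; _∷_)
import Data.Vec.Relation.Unary.All.Properties as VecAll
open import Data.Vec.Relation.Unary.Any as VecAny using (here; there)
import Data.Vec.Relation.Unary.Any.Properties as VecAny
open import Data.Vec.Relation.Unary.Unique.Propositional using (Unique)
open import Function.Base using (_∘_)
open import Function.Bundles using (_⇔_; mk⇔; Equivalence)
open import Function.Construct.Composition using (_⇔-∘_)
open import Function.Construct.Symmetry using (⇔-sym)
open import Level using (Level; 0ℓ; lift; lower)
open import Relation.Binary.Definitions using (DecidableEquality)
open import Relation.Binary.PropositionalEquality
  using (_≡_; refl; sym; trans; cong; cong₂; subst)
open import Relation.Nullary using (¬_; yes; no; contradiction)
open import Relation.Nullary.Decidable using (decidable-stable)
open import Relation.Unary using (Pred; Decidable)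

open Equivalence using (to; from)

private
  variable
    a p : Level
    A B C : Set a
    n : ℕ

-- Lists and vectors

sublists : List A → List (List A)
sublists []       = [] ∷ []
sublists (x ∷ xs) = List.map (x ∷_) (sublists xs) ++ sublists xs

-- Gives membership up to equality of lists, so that an image obtained by filtering `bitVectors n`
-- occurs literally among the candidate teams.
filter∈sublists : {P : Pred A p} (P? : Decidable P) (xs : List A) →
                  filter P? xs ∈ₗ sublists xs
filter∈sublists P? []       = here refl
filter∈sublists P? (x ∷ xs) with P? x
... | yes _ = ∈-++⁺ˡ (∈-map⁺ (x ∷_) (filter∈sublists P? xs))
... | no  _ = ∈-++⁺ʳ (List.map (x ∷_) (sublists xs)) (filter∈sublists P? xs)

bitVectors : (n : ℕ) → List (Vec Bool n)
bitVectors zero    = [] ∷ []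
bitVectors (suc n) =
  List.map (true ∷_) (bitVectors n) ++ List.map (false ∷_) (bitVectors n)

∈-bitVectors : (v : Vec Bool n) → v ∈ₗ bitVectors n
∈-bitVectors []          = here refl
∈-bitVectors (true ∷ v)  = ∈-++⁺ˡ (∈-map⁺ (true ∷_) (∈-bitVectors v))
∈-bitVectors (false ∷ v) =
  ∈-++⁺ʳ (List.map (true ∷_) (bitVectors _)) (∈-map⁺ (false ∷_) (∈-bitVectors v))

_≟ᵛ_ : DecidableEquality (Vec Bool n)
_≟ᵛ_ = ≡-dec Bool._≟_

foldr₁⁺ : (P : Pred A p) {_∙_ : A → A → A} →
          (∀ {x y} → P x → P y → P (x ∙ y)) →
          {xs : Vec A (suc n)} → VecAll.All P xs → P (foldr₁ _∙_ xs)
foldr₁⁺ P ∙-closed (px ∷ [])          = px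
foldr₁⁺ P ∙-closed (px ∷ pxs@(_ ∷ _)) = ∙-closed px (foldr₁⁺ P ∙-closed pxs)

zipWith-All : {P : Pred C p} {f : A → B → C} → (∀ x y → P (f x y)) →
              (xs : Vec A n) (ys : Vec B n) → VecAll.All P (zipWith f xs ys)
zipWith-All pf []       []       = []
zipWith-All pf (x ∷ xs) (y ∷ ys) = pf x y ∷ zipWith-All pf xs ys

-- Truth of the building blocks of the normal forms

singleton : Valuation → Team
singleton s t = t ≡ s

⊨-⋁⇔ : {X : Team} (φs : Vec Formula (suc n)) →
       X ⊨ foldr₁ _∨_ φs ⇔ VecAny.Any (X ⊨_) φs
⊨-⋁⇔ (φ ∷ [])     = mk⇔ here λ { (here x) → x }
⊨-⋁⇔ (φ ∷ ψ ∷ φs) = mk⇔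
  [ here , there ∘ to (⊨-⋁⇔ (ψ ∷ φs)) ]′
  λ { (here x) → inj₁ x ; (there x) → inj₂ (from (⊨-⋁⇔ (ψ ∷ φs)) x) }

-- If no team satisfying `φ` contained `s`, then `singleton s` would satisfy `~ φ`, and the
-- hypothesis would force it to be empty. The conclusion stays negated because no witness can be
-- extracted.
⊨-~~⁻ : {X : Team} {φ : Formula} → X ⊨ ~ ~ φ →
        ∀ {s} → X s → ¬ ((Y : Team) → Y ⊨ φ → ¬ Y s)
⊨-~~⁻ ⊨~~φ {s} s∈X ⊭φ =
  lower (⊨~~φ (singleton s) (λ { refl → s∈X })
          λ Y Y⊆s ⊨φ → lift λ t t∈Y →
            ⊭φ Y ⊨φ (subst Y (Y⊆s t∈Y) t∈Y))
        s refl

-- Any `s` in a subteam satisfying `~ φ` yields a singleton subteam that satisfies `φ`, hence is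
-- empty: a contradiction.
⊨-~~⁺ : {X : Team} {φ : Formula} →
        (∀ {s} → X s → singleton s ⊨ φ) → X ⊨ ~ ~ φ
⊨-~~⁺ ⊨φ Y Y⊆X ⊨~φ = lift λ s s∈Y →
  lower (⊨~φ (singleton s) (λ { refl → s∈Y }) (⊨φ (Y⊆X s∈Y))) s refl

-- The semantics shared by `lit` and `lit⇒`, so that conjunctions of literals are treated once for
-- both normal forms.
IsLiteral : (ℕ → Bool → Formula) → Set₁
IsLiteral L = ∀ X i b → X ⊨ L i b ⇔ (∀ s → X s → s i ≡ b)

lit-isLiteral : IsLiteral lit
lit-isLiteral X i true  = mk⇔ lower lift
lit-isLiteral X i false = mk⇔ lower lift

lit⇒-isLiteral : IsLiteral lit⇒
lit⇒-isLiteral X i true  = mk⇔ lower lift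
lit⇒-isLiteral X i false = mk⇔
  -- Were `s i` true, `singleton s` would satisfy `var i` and so be empty.
  (λ ⊨~i s s∈X → Bool.¬-not λ si≡true →
    lower (⊨~i (singleton s) (λ { refl → s∈X }) (lift λ { _ refl → si≡true })) s refl)
  (λ X≡false Y Y⊆X ⊨i → lift λ s s∈Y →
    contradiction (trans (sym (lower ⊨i s s∈Y)) (X≡false s (Y⊆X s∈Y))) λ ())

⊨-literals : {L : ℕ → Bool → Formula} → IsLiteral L →
             {X : Team} (is : Vec ℕ (suc n)) (v : Vec Bool (suc n)) →
             X ⊨ foldr₁ _∧_ (zipWith L is v) ⇔ (∀ s → X s → Vec.map s is ≡ v)
⊨-literals isL (i ∷ []) (b ∷ []) = mk⇔
  (λ x s s∈X → cong (_∷ []) (to (isL _ i b) x s s∈X))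
  (λ f → from (isL _ i b) λ s s∈X → proj₁ (∷-injective (f s s∈X)))
⊨-literals isL (i ∷ j ∷ is) (b ∷ c ∷ v) = mk⇔
  (λ (x , y) s s∈X → cong₂ _∷_ (to (isL _ i b) x s s∈X)
                               (to (⊨-literals isL (j ∷ is) (c ∷ v)) y s s∈X))
  (λ f → from (isL _ i b) (λ s s∈X → proj₁ (∷-injective (f s s∈X))) ,
         from (⊨-literals isL (j ∷ is) (c ∷ v)) λ s s∈X → proj₂ (∷-injective (f s s∈X)))

infix 4 _⊑[_]_ _IsImage[_]_

_⊑[_]_ : Team → Vec ℕ n → List (Vec Bool n) → Set
X ⊑[ is ] T = ∀ s → X s → Vec.map s is ∈ₗ T

-- Only membership in `T` counts: order and repetitions are left free.
_IsImage[_]_ : List (Vec Bool n) → Vec ℕ n → Team → Set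
T IsImage[ is ] X = X ⊑[ is ] T × (∀ v → v ∈ₗ T → ∃[ s ] X s × Vec.map s is ≡ v)

-- Each tensor factor holds exactly on teams whose valuations all restrict to one given vector, so a
-- split of `X` amounts to a cover by fibres of the restriction map.
⊨-⨂ : {X : Team} (is : Vec ℕ (suc n)) (T : List (Vec Bool (suc n))) →
      X ⊨ ⨂ (List.map (literals is) T) ⇔ X ⊑[ is ] T
⊨-⨂ is [] = mk⇔
  (λ x s s∈X → contradiction s∈X (lower x s))
  (λ f → lift λ s s∈X → contradiction (f s s∈X) λ ())
⊨-⨂ is (v ∷ []) = mk⇔
  (λ x s s∈X → here (to (⊨-literals lit-isLiteral is v) x s s∈X))
  (λ f → from (⊨-literals lit-isLiteral is v) λ s s∈X → Any.singleton⁻ (f s s∈X))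
⊨-⨂ {X = X} is (v ∷ T@(_ ∷ _)) = mk⇔
  (λ (Y , Z , _ , _ , (X⊆Y∪Z , _) , y , z) s s∈X →
    [ (λ s∈Y → here (to (⊨-literals lit-isLiteral is v) y s s∈Y))
    , (λ s∈Z → there (to (⊨-⨂ is T) z s s∈Z)) ]′ (X⊆Y∪Z s∈X))
  -- The two halves are the fibre over `v` and the preimage of the tail.
  (λ f → (λ s → X s × Vec.map s is ≡ v) , (λ s → X s × Vec.map s is ∈ₗ T) ,
         (λ {_} → proj₁) , (λ {_} → proj₁) ,
         ((λ {s} s∈X → Sum.map (s∈X ,_) (s∈X ,_) (Any.toSum (f s s∈X))) ,
          λ {_} → [ proj₁ , proj₁ ]′) ,
         from (⊨-literals lit-isLiteral is v) (λ _ → proj₂) ,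
         from (⊨-⨂ is T) (λ _ → proj₂))

⊨-¬¬⋁ : {X : Team} (is : Vec ℕ (suc n)) (T : List (Vec Bool (suc n))) →
        X ⊨ ¬¬⋁ (List.map (literals⇒ is) T) ⇔ X ⊑[ is ] T
⊨-¬¬⋁ is [] = mk⇔
  (λ x s s∈X → contradiction s∈X (lower x s))
  (λ f → lift λ s s∈X → contradiction (f s s∈X) λ ())
⊨-¬¬⋁ is T@(_ ∷ _) = mk⇔
  -- Membership in a list of bit vectors is decidable, which removes the double negation left by
  -- `⊨-~~⁻`.
  (λ x s s∈X → decidable-stable (any? (Vec.map s is ≟ᵛ_) T) λ s∉T →
    ⊨-~~⁻ x s∈X λ Y ⊨⋁ s∈Y →
      s∉T (Any.map (λ ⊨v → to (⊨-literals lit⇒-isLiteral is _) ⊨v s s∈Y)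
                   (Any.map⁻ (VecAny.fromList⁻ (to (⊨-⋁⇔ _) ⊨⋁)))))
  (λ f → ⊨-~~⁺ λ s∈X →
    from (⊨-⋁⇔ _) (VecAny.fromList⁺ (Any.map⁺
      (Any.map (λ eq → from (⊨-literals lit⇒-isLiteral is _) λ { _ refl → eq })
               (f _ s∈X)))))

-- Satisfaction on finite teams

-- The value `false` outside `is` is a placeholder; `⊨⇔⊩` concerns only formulas whose variables lie
-- in `is`.
extend : Vec ℕ n → Vec Bool n → Valuation
extend []       []      j = false
extend (i ∷ is) (b ∷ v) j with j ≟ i
... | yes _ = b
... | no  _ = extend is v j

extend-map : (is : Vec ℕ n) (s : Valuation) {i : ℕ} → i ∈ₗ toList is →
             extend is (Vec.map s is) i ≡ s i
extend-map (j ∷ is) s {i} i∈ with i ≟ j | i∈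
... | yes i≡j | _         = cong s (sym i≡j)
... | no  i≢j | here i≡j  = contradiction i≡j i≢j
... | no  _   | there i∈′ = extend-map is s i∈′

module FiniteTeams {n : ℕ} (is : Vec ℕ n) where

  private
    variable
      T U : List (Vec Bool n)
      X   : Team

  infix 4 _⊩_

  -- In the clause for ⊗, Y and Z need not be contained in T; by downward
  -- closure this makes no difference.
  _⊩_ : List (Vec Bool n) → Formula → Set
  T ⊩ var i    = ∀ v → v ∈ₗ T → extend is v i ≡ true
  T ⊩ negvar i = ∀ v → v ∈ₗ T → extend is v i ≡ false
  T ⊩ bot      = ∀ v → ¬ v ∈ₗ T
  T ⊩ dep js j = ∀ v w → v ∈ₗ T → w ∈ₗ T →
    All (λ i → extend is v i ≡ extend is w i) js → extend is v j ≡ extend is w j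
  T ⊩ φ ∧ ψ    = T ⊩ φ × T ⊩ ψ
  T ⊩ φ ⊗ ψ    = ∃[ Y ] ∃[ Z ] T ⊆ Y ++ Z × Y ⊩ φ × Z ⊩ ψ
  T ⊩ φ ∨ ψ    = T ⊩ φ ⊎ T ⊩ ψ
  T ⊩ φ ⇒ ψ    = ∀ U → U ⊆ T → U ⊩ φ → U ⊩ ψ

  -- Atoms are universal conditions on elements or pairs, a cover of `T` also covers `U`, and `⇒`
  -- already ranges over all subteams.
  ⊩-downward : ∀ φ → U ⊆ T → T ⊩ φ → U ⊩ φ
  ⊩-downward (var i)    U⊆T f = λ v v∈U → f v (U⊆T v∈U)
  ⊩-downward (negvar i) U⊆T f = λ v v∈U → f v (U⊆T v∈U)
  ⊩-downward bot        U⊆T f = λ v v∈U → f v (U⊆T v∈U)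
  ⊩-downward (dep js j) U⊆T f = λ v w v∈U w∈U → f v w (U⊆T v∈U) (U⊆T w∈U)
  ⊩-downward (φ ∧ ψ)    U⊆T (x , y) = ⊩-downward φ U⊆T x , ⊩-downward ψ U⊆T y
  ⊩-downward (φ ⊗ ψ)    U⊆T (Y , Z , T⊆Y++Z , yz) = Y , Z , T⊆Y++Z ∘ U⊆T , yz
  ⊩-downward (φ ∨ ψ)    U⊆T = Sum.map (⊩-downward φ U⊆T) (⊩-downward ψ U⊆T)
  ⊩-downward (φ ⇒ ψ)    U⊆T f V V⊆U = f V (U⊆T ∘ V⊆U)

  []⊩ : ∀ φ → [] ⊩ φ
  []⊩ (var i)    v ()
  []⊩ (negvar i) v ()
  []⊩ bot        v ()
  []⊩ (dep js j) v w ()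
  []⊩ (φ ∧ ψ)    = []⊩ φ , []⊩ ψ
  []⊩ (φ ⊗ ψ)    = [] , [] , (λ ()) , []⊩ φ , []⊩ ψ
  []⊩ (φ ∨ ψ)    = inj₁ ([]⊩ φ)
  []⊩ (φ ⇒ ψ) U U⊆[] _ = ⊩-downward ψ U⊆[] ([]⊩ ψ)

  -- The largest subteam of `X` with image inside `U`; it carries finite subteams back to teams of
  -- valuations.
  restrict : Team → List (Vec Bool n) → Team
  restrict X U s = X s × Vec.map s is ∈ₗ U

  restrict-image : U ⊆ T → T IsImage[ is ] X → U IsImage[ is ] restrict X U
  restrict-image {X = X} U⊆T (_ , back) = (λ _ → proj₂) , λ v v∈U →
    let s , s∈X , eq = back v (U⊆T v∈U) in
    s , (s∈X , subst (_∈ₗ _) (sym eq) v∈U) , eq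

  extend-image : ∀ {i s v} → i ∈ₗ toList is → Vec.map s is ≡ v → extend is v i ≡ s i
  extend-image i∈ refl = extend-map is _ i∈

  image-values : ∀ {i b} → i ∈ₗ toList is → T IsImage[ is ] X →
                 (∀ s → X s → s i ≡ b) ⇔ (∀ v → v ∈ₗ T → extend is v i ≡ b)
  image-values i∈ (forth , back) = mk⇔
    (λ f v v∈T → let s , s∈X , eq = back v v∈T in
      trans (extend-image i∈ eq) (f s s∈X))
    (λ f s s∈X → trans (sym (extend-image i∈ refl)) (f _ (forth s s∈X)))

  module Classical (em : ExcludedMiddle 0ℓ) where

    image : Team → List (Vec Bool n)
    image X = filter (λ v → em {∃[ s ] X s × Vec.map s is ≡ v}) (bitVectors n)

    image-isImage : ∀ X → image X IsImage[ is ] X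
    image-isImage X =
      (λ s s∈X → ∈-filter⁺ _ (∈-bitVectors _) (s , s∈X , refl)) ,
      (λ v v∈ → proj₂ (∈-filter⁻ _ {xs = bitVectors n} v∈))

    image-least : X ⊑[ is ] T → image X ⊆ T
    image-least X⊑T v∈ with proj₂ (image-isImage _) _ v∈
    ... | s , s∈X , refl = X⊑T s s∈X

    -- Induction on `φ`. Allowing any list `T` that is an image, rather than only `image X`, lets
    -- the case of `⇒` use a given sublist `U` itself as the image of `restrict X U`.
    ⊨⇔⊩ : ∀ φ → vars φ ⊆ toList is → T IsImage[ is ] X → X ⊨ φ ⇔ T ⊩ φ
    ⊨⇔⊩ (var i) vars⊆ im = mk⇔ (to values ∘ lower) (lift ∘ from values)
      where values = image-values (vars⊆ (here refl)) im
    ⊨⇔⊩ (negvar i) vars⊆ im = mk⇔ (to values ∘ lower) (lift ∘ from values)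
      where values = image-values (vars⊆ (here refl)) im
    ⊨⇔⊩ bot vars⊆ (forth , back) = mk⇔
      (λ ∅ v v∈T → let s , s∈X , _ = back v v∈T in lower ∅ s s∈X)
      (λ ∅ → lift λ s s∈X → ∅ _ (forth s s∈X))
    ⊨⇔⊩ (dep js j) vars⊆ (forth , back) = mk⇔
      (λ f v w v∈T w∈T v≈w →
        let s , s∈X , s≡v = back v v∈T
            t , t∈X , t≡w = back w w∈T
        in trans (extend-image j∈ s≡v) (trans
             (lower f s t s∈X t∈X (All.tabulate λ i∈ →
               trans (sym (extend-image (js⊆ i∈) s≡v))
                     (trans (All.lookup v≈w i∈) (extend-image (js⊆ i∈) t≡w))))
             (sym (extend-image j∈ t≡w))))
      (λ f → lift λ s t s∈X t∈X s≈t →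
        trans (sym (extend-image j∈ refl)) (trans
          (f _ _ (forth s s∈X) (forth t t∈X) (All.tabulate λ i∈ →
            trans (extend-image (js⊆ i∈) refl)
                  (trans (All.lookup s≈t i∈) (sym (extend-image (js⊆ i∈) refl)))))
          (extend-image j∈ refl)))
      where
      js⊆ : js ⊆ toList is
      js⊆ = vars⊆ ∘ ∈-++⁺ˡ
      j∈ : j ∈ₗ toList is
      j∈ = vars⊆ (∈-++⁺ʳ js (here refl))
    ⊨⇔⊩ (φ ∧ ψ) vars⊆ im =
      ⊨⇔⊩ φ (vars⊆ ∘ ∈-++⁺ˡ) im ×-⇔ ⊨⇔⊩ ψ (vars⊆ ∘ ∈-++⁺ʳ (vars φ)) im
    ⊨⇔⊩ (φ ∨ ψ) vars⊆ im =
      ⊨⇔⊩ φ (vars⊆ ∘ ∈-++⁺ˡ) im ⊎-⇔ ⊨⇔⊩ ψ (vars⊆ ∘ ∈-++⁺ʳ (vars φ)) im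
    ⊨⇔⊩ {X = X} (φ ⊗ ψ) vars⊆ (forth , back) = mk⇔
      (λ (Y , Z , _ , _ , (X⊆Y∪Z , _) , ⊨φ , ⊨ψ) →
        image Y , image Z ,
        (λ {v} v∈T → let s , s∈X , s≡v = back v v∈T in
          subst (_∈ₗ image Y ++ image Z) s≡v
            ([ ∈-++⁺ˡ ∘ proj₁ (image-isImage Y) s
             , ∈-++⁺ʳ (image Y) ∘ proj₁ (image-isImage Z) s ]′ (X⊆Y∪Z s∈X))) ,
        to (⊨⇔⊩ φ φ⊆ (image-isImage Y)) ⊨φ ,
        to (⊨⇔⊩ ψ ψ⊆ (image-isImage Z)) ⊨ψ)
      (λ (U , V , T⊆U++V , ⊩φ , ⊩ψ) →
        restrict X U , restrict X V , (λ {_} → proj₁) , (λ {_} → proj₁) ,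
        ((λ {s} s∈X → Sum.map (s∈X ,_) (s∈X ,_) (∈-++⁻ U (T⊆U++V (forth s s∈X)))) ,
         λ {_} → [ proj₁ , proj₁ ]′) ,
        -- `U` may contain vectors outside `T`, so the image of `restrict X U` is only known to be
        -- contained in `U`; downward closure bridges the gap.
        from (⊨⇔⊩ φ φ⊆ (image-isImage _)) (⊩-downward φ (image-least λ _ → proj₂) ⊩φ) ,
        from (⊨⇔⊩ ψ ψ⊆ (image-isImage _)) (⊩-downward ψ (image-least λ _ → proj₂) ⊩ψ))
      where
      φ⊆ : vars φ ⊆ toList is
      φ⊆ = vars⊆ ∘ ∈-++⁺ˡ
      ψ⊆ : vars ψ ⊆ toList is
      ψ⊆ = vars⊆ ∘ ∈-++⁺ʳ (vars φ)
    ⊨⇔⊩ {T = T} {X = X} (φ ⇒ ψ) vars⊆ im@(forth , _) = mk⇔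
      (λ f U (U⊆T : U ⊆ T) ⊩φ →
        let imU = restrict-image U⊆T im in
        to (⊨⇔⊩ ψ ψ⊆ imU) (f (restrict X U) (λ {_} → proj₁) (from (⊨⇔⊩ φ φ⊆ imU) ⊩φ)))
      -- An arbitrary subteam `Y` is replaced by its image, which lies in `T` because `Y` is
      -- contained in `X`.
      (λ f Y (Y⊆X : ∀ {s} → Y s → X s) ⊨φ →
        let imY = image-isImage Y in
        from (⊨⇔⊩ ψ ψ⊆ imY)
          (f (image Y) (image-least λ s s∈Y → forth s (Y⊆X s∈Y)) (to (⊨⇔⊩ φ φ⊆ imY) ⊨φ)))
      where
      φ⊆ : vars φ ⊆ toList is
      φ⊆ = vars⊆ ∘ ∈-++⁺ˡ
      ψ⊆ : vars ψ ⊆ toList is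
      ψ⊆ = vars⊆ ∘ ∈-++⁺ʳ (vars φ)

    satisfying : Formula → List (List (Vec Bool n))
    satisfying φ = filter (λ T → em {T ⊩ φ}) (sublists (bitVectors n))

    -- The extra [], which satisfies every φ, makes the index type a Fin (suc m).
    teams : ∀ φ → Fin (suc (List.length (satisfying φ))) → FinTeam n
    teams φ f = finTeam (deduplicate _≟ᵛ_ team) (deduplicate-! _≟ᵛ_ team)
      where team = List.lookup ([] ∷ satisfying φ) f

    ⊨⇔⊑teams : ∀ φ → vars φ ⊆ toList is →
               X ⊨ φ ⇔ (∃[ f ] X ⊑[ is ] elements (teams φ f))
    ⊨⇔⊑teams {X = X} φ vars⊆ = mk⇔
      (λ ⊨φ →
        -- The index sought is the position of `image X` itself; `there` passes over the extra `[]`.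
        let image∈ : image X ∈ₗ [] ∷ satisfying φ
            image∈ = there (∈-filter⁺ _ (filter∈sublists _ (bitVectors n))
                                        (to ⇔image ⊨φ))
        in Any.index image∈ , λ s s∈X → ∈-deduplicate⁺ _≟ᵛ_
             (subst (_ ∈ₗ_) (lookup-index image∈) (proj₁ (image-isImage X) s s∈X)))
      (λ (f , X⊑) → from ⇔image (⊩-downward φ
        (image-least λ s s∈X → ∈-deduplicate⁻ _≟ᵛ_ _ (X⊑ s s∈X))
        (listed⊩ (∈-lookup {xs = [] ∷ satisfying φ} f))))
      where
      ⇔image : X ⊨ φ ⇔ image X ⊩ φ
      ⇔image = ⊨⇔⊩ φ vars⊆ (image-isImage X)

      listed⊩ : T ∈ₗ [] ∷ satisfying φ → T ⊩ φ
      listed⊩ (here refl) = []⊩ φ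
      listed⊩ (there T∈)  = proj₂ (∈-filter⁻ _ {xs = sublists (bitVectors n)} T∈)

-- Normal forms

-- Used for both normal forms, with `Q f` the containment of the image in the team of index `f`.
⊨-⋁tabulate⇔ : ∀ {m} {X : Team} {φ : Fin (suc m) → Formula} {Q : Fin (suc m) → Set} →
               (∀ f → X ⊨ φ f ⇔ Q f) → X ⊨ ⋁ φ ⇔ (∃[ f ] Q f)
⊨-⋁tabulate⇔ {φ = φ} φ⇔Q = mk⇔
  (λ x → let f , ⊨φ = VecAny.tabulate⁻ {f = φ} (to (⊨-⋁⇔ _) x) in f , to (φ⇔Q f) ⊨φ)
  (λ (f , q) → from (⊨-⋁⇔ _) (VecAny.tabulate⁺ {f = φ} f (from (φ⇔Q f) q)))

dnf-PD∨ : ∀ {m} (is : Vec ℕ (suc n)) (X : Fin (suc m) → FinTeam (suc n)) → PD∨ (dnf is X)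
dnf-PD∨ is X = foldr₁⁺ PD∨ _∨_
  (VecAll.tabulate⁺ {f = ⨂ ∘ List.map (literals is) ∘ elements ∘ X}
    λ f → ⨂-PD∨ (elements (X f)))
  where
  literals-PD∨ : ∀ v → PD∨ (literals is v)
  literals-PD∨ v =
    foldr₁⁺ PD∨ _∧_ (zipWith-All (λ { i true → var i ; i false → negvar i }) is v)

  ⨂-PD∨ : ∀ T → PD∨ (⨂ (List.map (literals is) T))
  ⨂-PD∨ []        = bot
  ⨂-PD∨ T@(_ ∷ _) =
    foldr₁⁺ PD∨ _⊗_ (VecAll.fromList⁺ (All.map⁺ (All.universal literals-PD∨ T)))

dnnf-InqL : ∀ {m} (is : Vec ℕ (suc n)) (X : Fin (suc m) → FinTeam (suc n)) → InqL (dnnf is X)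
dnnf-InqL is X = foldr₁⁺ InqL _∨_
  (VecAll.tabulate⁺ {f = ¬¬⋁ ∘ List.map (literals⇒ is) ∘ elements ∘ X}
    λ f → ¬¬⋁-InqL (elements (X f)))
  where
  literals⇒-InqL : ∀ v → InqL (literals⇒ is v)
  literals⇒-InqL v =
    foldr₁⁺ InqL _∧_ (zipWith-All (λ { i true → var i ; i false → var i ⇒ bot }) is v)

  ¬¬⋁-InqL : ∀ T → InqL (¬¬⋁ (List.map (literals⇒ is) T))
  ¬¬⋁-InqL []        = bot
  ¬¬⋁-InqL T@(_ ∷ _) =
    (foldr₁⁺ InqL _∨_ (VecAll.fromList⁺ (All.map⁺ (All.universal literals⇒-InqL T))) ⇒ bot) ⇒ bot

InqL⇒PID : ∀ {φ} → InqL φ → PID φ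
InqL⇒PID (var i) = var i
InqL⇒PID bot     = bot
InqL⇒PID (x ∧ y) = InqL⇒PID x ∧ InqL⇒PID y
InqL⇒PID (x ∨ y) = InqL⇒PID x ∨ InqL⇒PID y
InqL⇒PID (x ⇒ y) = InqL⇒PID x ⇒ InqL⇒PID y

mainTheorem2 : ExcludedMiddle 0ℓ →
    (n : ℕ) (is : Vec ℕ (suc n)) → Unique is →
    (φ : Formula) → vars φ ⊆ toList is →
    Σ[ m ∈ ℕ ] Σ[ X ∈ (Fin (suc m) → FinTeam (suc n)) ]
    (PD∨ (dnf is X) × φ ≋ dnf is X) ×
    (InqL (dnnf is X) × PID (dnnf is X) × φ ≋ dnnf is X)
mainTheorem2 em n is _ φ vars⊆ =
  _ , X ,
  -- One family `X` serves both forms: each is true on `Y` exactly when the image of `Y` lies in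
  -- some `X f`, which is also the criterion `φ⇔` for `φ`.
  (dnf-PD∨ is X , λ Y →
    ⇔-sym (⊨-⋁tabulate⇔ λ f → ⊨-⨂ is (elements (X f))) ⇔-∘ φ⇔ Y) ,
  (dnnf-InqL is X , InqL⇒PID (dnnf-InqL is X) , λ Y →
    ⇔-sym (⊨-⋁tabulate⇔ λ f → ⊨-¬¬⋁ is (elements (X f))) ⇔-∘ φ⇔ Y)
  where
  open FiniteTeams is
  open Classical em

  X = teams φ

  φ⇔ : ∀ Y → Y ⊨ φ ⇔ (∃[ f ] Y ⊑[ is ] elements (X f))
  φ⇔ Y = ⊨⇔⊑teams φ vars⊆
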